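{- The generating function $$F_{(213,312)}(x,p,q,u,v,s,t)=\sum_{n\ge0}\ \sum_{\pi\in S_n(213,312)} x^n p^{\operatorname{asc}(\pi)}q^{\operatorname{des}(\pi)}u^{\operatorname{lrmax}(\pi)}v^{\operatorname{rlmax}(\pi)}s^{\operatorname{lrmin}(\pi)}t^{\operatorname{rlmin}(\pi)}$$ is equal to $$1 + xuvst + \frac{p q s t^2 u^2 v^2 x^3}{(-1 + p t u x) (-1 + p u x + q v x)} + \frac{q s^2 t u v^2 x^2}{1 - q s v x} + \frac{p s t^2 u^2 v x^2}{1 - p t u x} + \frac{p q s^2 t u^2 v^2 x^3}{(-1 + p u x + q v x) (-1 + q s v x)}.$$
   Context: For $n\ge 0$, $S_n$ denotes the set of permutations $\pi=\pi_1\cdots\pi_n$ of $[n]=\{1,\dots,n\}$ ($S_0$ consists of the empty permutation, for which all statistics are $0$). $\pi$ avoids a pattern $\tau\in S_k$ if no subsequence $\pi_{i_1}\cdots\pi_{i_k}$ ($i_1<\dots<i_k$) satisfies $\pi_{i_a}<\pi_{i_b}\iff\tau_a<\tau_b$; $S_n(\tau,\rho)$ is the set of permutations in $S_n$ avoiding both $\tau$ and $\rho$. $\operatorname{asc}(\pi)$ (resp. $\operatorname{des}(\pi)$) is the number of $i\in[n-1]$ with $\pi_i<\pi_{i+1}$ (resp. $\pi_i>\pi_{i+1}$). $\pi_i$ is a left-to-right maximum (resp. minimum) if it is larger (resp. smaller) than every $\pi_j$ with $j<i$, and a right-to-left maximum (resp. minimum) if it is larger (resp. smaller) than every $\pi_j$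 with $j>i$; $\operatorname{lrmax},\operatorname{lrmin},\operatorname{rlmax},\operatorname{rlmin}$ count these. -}

module Defs where

open import Algebra.Bundles using (CommutativeRing)
open import Data.Fin as Fin using (Fin; zero; suc; toℕ; inject₁; #_)
open import Data.Fin.Properties as Fin using (all?)
open import Data.Integer.Properties using (+-*-commutativeRing)
open import Data.List.Base as List using (List; []; _∷_; filter; allFin; cartesianProductWith)
open import Data.List.Membership.Propositional using (_∈_)
open import Data.List.Membership.Propositional.Properties using (∈-allFin; ∈-filter⁺; ∈-filter⁻; ∈-cartesianProductWith⁺)
open import Data.List.Relation.Unary.AllPairs using ([]; _∷_)
open import Data.List.Relation.Unary.All using ([])
open import Data.List.Relation.Unary.Any using (here)
open import Data.List.Relation.Unary.Unique.Propositional using () renaming (Unique to UniqueList)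
open import Data.List.Relation.Unary.Unique.Propositional.Properties using (allFin⁺; filter⁺; cartesianProductWith⁺)
open import Data.Nat.Base using (ℕ; zero; suc; _∸_)
open import Data.Product.Base using (∃-syntax; _×_; _,_; proj₂)
open import Data.Vec.Base as Vec using (Vec; []; _∷_; lookup; count)
open import Data.Vec.Properties using (∷-injective)
open import Data.Vec.Relation.Unary.AllPairs using (allPairs?)
open import Data.Vec.Relation.Unary.Unique.Propositional using (Unique)
open import Function.Base using (_∘_)
open import Function.Bundles using (_⇔_; mk⇔; Equivalence)
open import Level using (Level; _⊔_; 0ℓ)
open import Relation.Binary.PropositionalEquality using (refl)
open import Relation.Nullary using (Dec; ¬_; ¬?; map′; _×-dec_; _→-dec_)

import Algebra.Properties.Semiring.Exp
import Algebra.Properties.Monoid.Sum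
import Algebra.Properties.Ring
import Algebra.Properties.CommutativeSemigroup
import Relation.Binary.Reasoning.Setoid

private
  variable
    k m n : ℕ

module PowerSeries {c ℓ : Level} (R : CommutativeRing c ℓ) where

  private
    module R = CommutativeRing R
    open R using (Carrier)
    open Algebra.Properties.Monoid.Sum R.+-monoid using (sum⁺-syntax)
    open Algebra.Properties.Ring R.ring
      using (-0#≈0#; -‿distribˡ-*; -‿distribʳ-*; -‿involutive)
    open Algebra.Properties.CommutativeSemigroup
      (CommutativeRing.+-commutativeSemigroup R) using (interchange; x∙yz≈y∙xz)
    open Relation.Binary.Reasoning.Setoid R.setoid

  record Series : Set c where
    no-eta-equality
    constructor series
    field
      coeff : ℕ → Carrier

  open Series public

  infixl 7 _*_
  infixl 6 _+_
  infix  8 -_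
  infix  4 _≈_

  record _≈_ (f g : Series) : Set ℓ where
    constructor pointwise
    field
      at : ∀ n → coeff f n R.≈ coeff g n

  open _≈_ public

  C : Carrier → Series
  coeff (C a) zero    = a
  coeff (C a) (suc _) = R.0#

  X : Series
  coeff X zero          = R.0#
  coeff X (suc zero)    = R.1#
  coeff X (suc (suc _)) = R.0#

  0ₛ 1ₛ : Series
  0ₛ = C R.0#
  1ₛ = C R.1#

  _+_ : Series → Series → Series
  coeff (f + g) n = coeff f n R.+ coeff g n

  -_ : Series → Series
  coeff (- f) n = R.- coeff f n

  conv : (ℕ → Carrier) → (ℕ → Carrier) → ℕ → Carrier
  conv a b n = ∑[ i ≤ n ] (a (toℕ i) R.* b (n ∸ toℕ i))

  _*_ : Series → Series → Series
  coeff (f * g) n = conv (coeff f) (coeff g) n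

  private
    Seq : Set c
    Seq = ℕ → Carrier

    _≗_ : Seq → Seq → Set ℓ
    a ≗ b = ∀ n → a n R.≈ b n

    conv-suc : ∀ (a b : Seq) n →
               conv a b (suc n) R.≈ a 0 R.* b (suc n) R.+ conv (a ∘ suc) b n
    conv-suc a b n = R.refl

    conv-cong : ∀ {a a′ b b′ : Seq} → a ≗ a′ → b ≗ b′ → conv a b ≗ conv a′ b′
    conv-cong p q zero    = R.+-congʳ (R.*-cong (p 0) (q 0))
    conv-cong p q (suc n) =
      R.+-cong (R.*-cong (p 0) (q (suc n))) (conv-cong (p ∘ suc) q n)

    conv-sucʳ : ∀ (a b : Seq) n →
                conv a b (suc n) R.≈ a (suc n) R.* b 0 R.+ conv a (b ∘ suc) n
    conv-sucʳ a b zero    = x∙yz≈y∙xz _ _ _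
    conv-sucʳ a b (suc n) = begin
      a 0 R.* b (suc (suc n)) R.+ conv (a ∘ suc) b (suc n)
        ≈⟨ R.+-congˡ (conv-sucʳ (a ∘ suc) b n) ⟩
      a 0 R.* b (suc (suc n)) R.+ (a (suc (suc n)) R.* b 0 R.+ conv (a ∘ suc) (b ∘ suc) n)
        ≈⟨ x∙yz≈y∙xz _ _ _ ⟩
      a (suc (suc n)) R.* b 0 R.+ conv a (b ∘ suc) (suc n) ∎

    conv-comm : ∀ (a b : Seq) → conv a b ≗ conv b a
    conv-comm a b zero    = R.+-congʳ (R.*-comm _ _)
    conv-comm a b (suc n) = R.trans (conv-sucʳ a b n)
      (R.+-cong (R.*-comm _ _) (conv-comm a (b ∘ suc) n))

    conv-zeroˡ : ∀ (a b : Seq) → (∀ n → a n R.≈ R.0#) → ∀ n → conv a b n R.≈ R.0#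
    conv-zeroˡ a b a≈0 zero    =
      R.trans (R.+-identityʳ _) (R.trans (R.*-congʳ (a≈0 0)) (R.zeroˡ _))
    conv-zeroˡ a b a≈0 (suc n) = R.trans
      (R.+-cong (R.trans (R.*-congʳ (a≈0 0)) (R.zeroˡ _))
                (conv-zeroˡ (a ∘ suc) b (a≈0 ∘ suc) n))
      (R.+-identityˡ _)

    conv-constˡ : ∀ x (b : Seq) n → conv (coeff (C x)) b n R.≈ x R.* b n
    conv-constˡ x b zero    = R.+-identityʳ _
    conv-constˡ x b (suc n) = R.trans
      (R.+-congˡ (conv-zeroˡ _ b (λ _ → R.refl) n)) (R.+-identityʳ _)

    conv-distribʳ : ∀ (d a b : Seq) n →
                    conv (λ i → a i R.+ b i) d n R.≈ conv a d n R.+ conv b d n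
    conv-distribʳ d a b zero    = begin
      (a 0 R.+ b 0) R.* d 0 R.+ R.0#            ≈⟨ R.+-cong (R.distribʳ _ _ _) (R.sym (R.+-identityˡ _)) ⟩
      (a 0 R.* d 0 R.+ b 0 R.* d 0) R.+ (R.0# R.+ R.0#) ≈⟨ interchange _ _ _ _ ⟩
      (a 0 R.* d 0 R.+ R.0#) R.+ (b 0 R.* d 0 R.+ R.0#) ∎
    conv-distribʳ d a b (suc n) = R.trans
      (R.+-cong (R.distribʳ _ _ _) (conv-distribʳ d (a ∘ suc) (b ∘ suc) n))
      (interchange _ _ _ _)

    conv-scaleˡ : ∀ x (a b : Seq) n → conv (λ i → x R.* a i) b n R.≈ x R.* conv a b n
    conv-scaleˡ x a b zero    = begin
      (x R.* a 0) R.* b 0 R.+ R.0# ≈⟨ R.+-identityʳ _ ⟩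
      (x R.* a 0) R.* b 0          ≈⟨ R.*-assoc _ _ _ ⟩
      x R.* (a 0 R.* b 0)          ≈⟨ R.*-congˡ (R.+-identityʳ _) ⟨
      x R.* (a 0 R.* b 0 R.+ R.0#) ∎
    conv-scaleˡ x a b (suc n) = R.trans
      (R.+-cong (R.*-assoc _ _ _) (conv-scaleˡ x (a ∘ suc) b n))
      (R.sym (R.distribˡ _ _ _))

    conv-assoc : ∀ (a b d : Seq) → conv (conv a b) d ≗ conv a (conv b d)
    conv-assoc a b d zero    = R.+-congʳ (begin
      (a 0 R.* b 0 R.+ R.0#) R.* d 0 ≈⟨ R.*-congʳ (R.+-identityʳ _) ⟩
      (a 0 R.* b 0) R.* d 0          ≈⟨ R.*-assoc _ _ _ ⟩
      a 0 R.* (b 0 R.* d 0)          ≈⟨ R.*-congˡ (R.+-identityʳ _) ⟨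
      a 0 R.* (b 0 R.* d 0 R.+ R.0#) ∎)
    conv-assoc a b d (suc n) = begin
      (a 0 R.* b 0 R.+ R.0#) R.* d (suc n) R.+ conv (conv a b ∘ suc) d n
        ≈⟨ R.+-cong
             (R.trans (R.*-congʳ (R.+-identityʳ _)) (R.*-assoc _ _ _))
             (R.trans (conv-distribʳ d (λ i → a 0 R.* b (suc i)) (conv (a ∘ suc) b) n)
                      (R.+-cong (conv-scaleˡ (a 0) (b ∘ suc) d n)
                                (conv-assoc (a ∘ suc) b d n))) ⟩
      a 0 R.* (b 0 R.* d (suc n)) R.+ (a 0 R.* conv (b ∘ suc) d n R.+ conv (a ∘ suc) (conv b d) n)
        ≈⟨ R.+-assoc _ _ _ ⟨
      (a 0 R.* (b 0 R.* d (suc n)) R.+ a 0 R.* conv (b ∘ suc) d n) R.+ conv (a ∘ suc) (conv b d) n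
        ≈⟨ R.+-congʳ (R.distribˡ _ _ _) ⟨
      a 0 R.* conv b d (suc n) R.+ conv (a ∘ suc) (conv b d) n ∎

    0ₛ-coeff : ∀ n → coeff 0ₛ n R.≈ R.0#
    0ₛ-coeff zero    = R.refl
    0ₛ-coeff (suc _) = R.refl

    *-comm : ∀ f g → f * g ≈ g * f
    *-comm f g = pointwise (conv-comm (coeff f) (coeff g))

    *-identityˡ : ∀ f → 1ₛ * f ≈ f
    *-identityˡ f = pointwise λ n →
      R.trans (conv-constˡ R.1# (coeff f) n) (R.*-identityˡ _)

    *-distribʳ : ∀ h f g → (f + g) * h ≈ f * h + g * h
    *-distribʳ h f g = pointwise (conv-distribʳ (coeff h) (coeff f) (coeff g))

    ≈-trans : ∀ {f g h} → f ≈ g → g ≈ h → f ≈ h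
    ≈-trans p q = pointwise λ n → R.trans (at p n) (at q n)

    +-cong : ∀ {f f′ g g′} → f ≈ f′ → g ≈ g′ → f + g ≈ f′ + g′
    +-cong p q = pointwise λ n → R.+-cong (at p n) (at q n)

  ring : CommutativeRing c ℓ
  ring = record
    { Carrier = Series
    ; _≈_     = _≈_
    ; _+_     = _+_
    ; _*_     = _*_
    ; -_      = -_
    ; 0#      = 0ₛ
    ; 1#      = 1ₛ
    ; isCommutativeRing = record
      { isRing = record
        { +-isAbelianGroup = record
          { isGroup = record
            { isMonoid = record
              { isSemigroup = record
                { isMagma = record
                  { isEquivalence = record
                    { refl  = pointwise λ _ → R.refl
                    ; sym   = λ p → pointwise λ n → R.sym (at p n)
                    ; trans = ≈-trans
                    }
                  ; ∙-cong = +-cong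
                  }
                ; assoc = λ f g h → pointwise λ n → R.+-assoc _ _ _
                }
              ; identity =
                  (λ f → pointwise λ n → R.trans (R.+-congʳ (0ₛ-coeff n)) (R.+-identityˡ _))
                , (λ f → pointwise λ n → R.trans (R.+-congˡ (0ₛ-coeff n)) (R.+-identityʳ _))
              }
            ; inverse =
                (λ f → pointwise λ n → R.trans (R.-‿inverseˡ _) (R.sym (0ₛ-coeff n)))
              , (λ f → pointwise λ n → R.trans (R.-‿inverseʳ _) (R.sym (0ₛ-coeff n)))
            ; ⁻¹-cong = λ p → pointwise λ n → R.-‿cong (at p n)
            }
          ; comm = λ f g → pointwise λ n → R.+-comm _ _
          }
        ; *-cong = λ p q → pointwise (conv-cong (at p) (at q))
        ; *-assoc = λ f g h → pointwise (conv-assoc (coeff f) (coeff g) (coeff h))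
        ; *-identity = *-identityˡ , λ f → ≈-trans (*-comm f 1ₛ) (*-identityˡ f)
        ; distrib =
            (λ h f g → ≈-trans (*-comm h (f + g))
              (≈-trans (*-distribʳ h f g) (+-cong (*-comm f h) (*-comm g h))))
          , *-distribʳ
        }
      ; *-comm = *-comm
      }
    }

  -- A series is invertible when its constant coefficient is; the quotient
  -- f / g is defined for such g by long division and characterised by
  -- (f / g) * g ≈ f, see /-* below.
  record InvertibleConstant (g : Series) : Set (c ⊔ ℓ) where
    constructor invertible
    field
      inverse   : Carrier
      isInverse : inverse R.* coeff g 0 R.≈ R.1#

  open InvertibleConstant

  infixl 7 _/_

  -- With a the leading coefficient of the quotient, f - a g = x * remainder f g.
  remainder : Series → (g : Series) → ⦃ InvertibleConstant g ⦄ → Series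
  coeff (remainder f g ⦃ g₀ ⦄) n =
    coeff f (suc n) R.- (inverse g₀ R.* coeff f 0) R.* coeff g (suc n)

  _/_ : Series → (g : Series) → ⦃ InvertibleConstant g ⦄ → Series
  coeff (f / g) (suc n)       = coeff (remainder f g / g) n
  coeff ((f / g) ⦃ g₀ ⦄) zero = inverse g₀ R.* coeff f 0

  /-* : ∀ f g → ⦃ _ : InvertibleConstant g ⦄ → (f / g) * g ≈ f
  /-* f g ⦃ g₀ ⦄ = pointwise (go f)
    where
    go : ∀ f n → coeff ((f / g) * g) n R.≈ coeff f n
    go f zero = begin
      (inverse g₀ R.* coeff f 0) R.* coeff g 0 R.+ R.0# ≈⟨ R.+-identityʳ _ ⟩
      (inverse g₀ R.* coeff f 0) R.* coeff g 0          ≈⟨ R.*-congʳ (R.*-comm _ _) ⟩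
      (coeff f 0 R.* inverse g₀) R.* coeff g 0          ≈⟨ R.*-assoc _ _ _ ⟩
      coeff f 0 R.* (inverse g₀ R.* coeff g 0)          ≈⟨ R.*-congˡ (isInverse g₀) ⟩
      coeff f 0 R.* R.1#                                ≈⟨ R.*-identityʳ _ ⟩
      coeff f 0                                         ∎
    go f (suc n) = begin
      y R.+ conv (coeff (f / g) ∘ suc) (coeff g) n ≈⟨ R.+-congˡ (go (remainder f g) n) ⟩
      y R.+ (coeff f (suc n) R.- y)                ≈⟨ x∙yz≈y∙xz _ _ _ ⟩
      coeff f (suc n) R.+ (y R.- y)                ≈⟨ R.+-congˡ (R.-‿inverseʳ _) ⟩
      coeff f (suc n) R.+ R.0#                     ≈⟨ R.+-identityʳ _ ⟩
      coeff f (suc n)                              ∎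
      where y = (inverse g₀ R.* coeff f 0) R.* coeff g (suc n)

  private
    *X-constant : ∀ g → coeff (g * X) 0 R.≈ R.0#
    *X-constant g = R.trans (R.+-identityʳ _) (R.zeroʳ _)

  instance
    1-invertible : InvertibleConstant 1ₛ
    1-invertible = invertible R.1# (R.*-identityˡ _)

    neg-invertible : ∀ {f} → ⦃ InvertibleConstant f ⦄ → InvertibleConstant (- f)
    neg-invertible {f} ⦃ f₀ ⦄ = invertible (R.- inverse f₀) (begin
      R.- inverse f₀ R.* R.- coeff f 0       ≈⟨ -‿distribˡ-* _ _ ⟨
      R.- (inverse f₀ R.* R.- coeff f 0)     ≈⟨ R.-‿cong (-‿distribʳ-* _ _) ⟨
      R.- (R.- (inverse f₀ R.* coeff f 0))   ≈⟨ -‿involutive _ ⟩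
      inverse f₀ R.* coeff f 0               ≈⟨ isInverse f₀ ⟩
      R.1#                                   ∎)

    +X-invertible : ∀ {f g} → ⦃ InvertibleConstant f ⦄ → InvertibleConstant (f + g * X)
    +X-invertible {f} {g} ⦃ f₀ ⦄ = invertible (inverse f₀) (begin
      inverse f₀ R.* (coeff f 0 R.+ coeff (g * X) 0) ≈⟨ R.*-congˡ (R.+-congˡ (*X-constant g)) ⟩
      inverse f₀ R.* (coeff f 0 R.+ R.0#)            ≈⟨ R.*-congˡ (R.+-identityʳ _) ⟩
      inverse f₀ R.* coeff f 0                       ≈⟨ isInverse f₀ ⟩
      R.1#                                           ∎)

    -X-invertible : ∀ {f g} → ⦃ InvertibleConstant f ⦄ → InvertibleConstant (f + - (g * X))
    -X-invertible {f} {g} ⦃ f₀ ⦄ = invertible (inverse f₀) (begin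
      inverse f₀ R.* (coeff f 0 R.+ R.- coeff (g * X) 0)
        ≈⟨ R.*-congˡ (R.+-congˡ (R.trans (R.-‿cong (*X-constant g)) -0#≈0#)) ⟩
      inverse f₀ R.* (coeff f 0 R.+ R.0#) ≈⟨ R.*-congˡ (R.+-identityʳ _) ⟩
      inverse f₀ R.* coeff f 0            ≈⟨ isInverse f₀ ⟩
      R.1#                                ∎)

    *-invertible : ∀ {f g} → ⦃ InvertibleConstant f ⦄ → ⦃ InvertibleConstant g ⦄ →
                   InvertibleConstant (f * g)
    *-invertible {f} {g} ⦃ f₀ ⦄ ⦃ g₀ ⦄ = invertible (inverse g₀ R.* inverse f₀) (begin
      (inverse g₀ R.* inverse f₀) R.* (coeff f 0 R.* coeff g 0 R.+ R.0#)
        ≈⟨ R.*-congˡ (R.+-identityʳ _) ⟩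
      (inverse g₀ R.* inverse f₀) R.* (coeff f 0 R.* coeff g 0) ≈⟨ R.*-assoc _ _ _ ⟩
      inverse g₀ R.* (inverse f₀ R.* (coeff f 0 R.* coeff g 0)) ≈⟨ R.*-congˡ (R.*-assoc _ _ _) ⟨
      inverse g₀ R.* ((inverse f₀ R.* coeff f 0) R.* coeff g 0)
        ≈⟨ R.*-congˡ (R.*-congʳ (isInverse f₀)) ⟩
      inverse g₀ R.* (R.1# R.* coeff g 0) ≈⟨ R.*-congˡ (R.*-identityˡ _) ⟩
      inverse g₀ R.* coeff g 0            ≈⟨ isInverse g₀ ⟩
      R.1#                                ∎)

-- ℤ⟦ k ⟧ is the ring of formal power series in k variables over ℤ, built
-- one variable at a time; var k zero is the outermost variable.

ℤ⟦_⟧ : ℕ → CommutativeRing 0ℓ 0ℓ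
ℤ⟦ zero  ⟧ = +-*-commutativeRing
ℤ⟦ suc k ⟧ = PowerSeries.ring ℤ⟦ k ⟧

var : ∀ k → Fin k → CommutativeRing.Carrier ℤ⟦ k ⟧
var (suc k) zero    = PowerSeries.X ℤ⟦ k ⟧
var (suc k) (suc i) = PowerSeries.C ℤ⟦ k ⟧ (var k i)

-- A permutation is given in one-line notation by the word π₁⋯πₙ, with
-- both positions and values shifted from {1,…,n} to Fin n = {0,…,n-1}.

words : ∀ k n → List (Vec (Fin n) k)
words zero    n = [] ∷ []
words (suc k) n = cartesianProductWith _∷_ (allFin n) (words k n)

words-complete : (w : Vec (Fin n) k) → w ∈ words k n
words-complete []      = here refl
words-complete (a ∷ w) = ∈-cartesianProductWith⁺ _∷_ (∈-allFin a) (words-complete w)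

words-unique : ∀ k n → UniqueList (words k n)
words-unique zero    n = [] ∷ []
words-unique (suc k) n = cartesianProductWith⁺ _∷_ ∷-injective (allFin⁺ n) (words-unique k n)

unique? : (w : Vec (Fin n) k) → Dec (Unique w)
unique? = allPairs? λ a b → ¬? (a Fin.≟ b)

S : ∀ n → List (Vec (Fin n) n)
S n = filter unique? (words n n)

∈-S⇔Unique : (π : Vec (Fin n) n) → π ∈ S n ⇔ Unique π
∈-S⇔Unique π = mk⇔ (proj₂ ∘ ∈-filter⁻ unique? {xs = words _ _})
                   (∈-filter⁺ unique? (words-complete π))

S-unique : ∀ n → UniqueList (S n)
S-unique n = filter⁺ unique? (words-unique n n)

-- i is the list of positions i₁ < ⋯ < iₖ of the subsequence of π.
IsOccurrence : Vec (Fin k) k → Vec (Fin n) n → Vec (Fin n) k → Set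
IsOccurrence τ π i =
  (∀ a b → a Fin.< b → lookup i a Fin.< lookup i b) ×
  (∀ a b → lookup π (lookup i a) Fin.< lookup π (lookup i b) ⇔ lookup τ a Fin.< lookup τ b)

Avoids : Vec (Fin k) k → Vec (Fin n) n → Set
Avoids τ π = ¬ (∃[ i ] IsOccurrence τ π i)

isOccurrence? : (τ : Vec (Fin k) k) (π : Vec (Fin n) n) (i : Vec (Fin n) k) →
                Dec (IsOccurrence τ π i)
isOccurrence? τ π i =
  all? (λ a → all? λ b → (a Fin.<? b) →-dec (lookup i a Fin.<? lookup i b))
  ×-dec
  all? (λ a → all? λ b →
    (lookup π (lookup i a) Fin.<? lookup π (lookup i b)) ⇔-dec (lookup τ a Fin.<? lookup τ b))
  where
  _⇔-dec_ : ∀ {A B : Set} → Dec A → Dec B → Dec (A ⇔ B)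
  a? ⇔-dec b? = map′ (λ (f , g) → mk⇔ f g) (λ e → Equivalence.to e , Equivalence.from e)
                     ((a? →-dec b?) ×-dec (b? →-dec a?))

avoids? : (τ : Vec (Fin k) k) (π : Vec (Fin n) n) → Dec (Avoids τ π)
avoids? τ π = ¬? (anyVec? (isOccurrence? τ π))
  where
  anyVec? : ∀ {k n} {P : Vec (Fin n) k → Set} → (∀ w → Dec (P w)) → Dec (∃[ w ] P w)
  anyVec? {zero}  P? = map′ (λ p → [] , p) (λ { ([] , p) → p }) (P? [])
  anyVec? {suc k} P? = map′ (λ (a , w , p) → a ∷ w , p) (λ { (a ∷ w , p) → a , w , p })
                            (Fin.any? λ a → anyVec? λ w → P? (a ∷ w))

S⟨_,_⟩ : Vec (Fin k) k → Vec (Fin m) m → ∀ n → List (Vec (Fin n) n)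
S⟨ τ , ρ ⟩ n = filter (λ π → avoids? τ π ×-dec avoids? ρ π) (S n)

[213] [312] : Vec (Fin 3) 3
[213] = # 1 ∷ # 0 ∷ # 2 ∷ []
[312] = # 2 ∷ # 0 ∷ # 1 ∷ []

asc des : Vec (Fin n) k → ℕ
asc {k = zero}  π = 0
asc {k = suc k} π =
  count (λ i → lookup π (inject₁ i) Fin.<? lookup π (suc i)) (Vec.allFin k)
des {k = zero}  π = 0
des {k = suc k} π =
  count (λ i → lookup π (suc i) Fin.<? lookup π (inject₁ i)) (Vec.allFin k)

lrmax lrmin rlmax rlmin : Vec (Fin n) k → ℕ
lrmax π = count (λ i → all? λ j → (j Fin.<? i) →-dec (lookup π j Fin.<? lookup π i)) (Vec.allFin _)
lrmin π = count (λ i → all? λ j → (j Fin.<? i) →-dec (lookup π i Fin.<? lookup π j)) (Vec.allFin _)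
rlmax π = count (λ i → all? λ j → (i Fin.<? j) →-dec (lookup π j Fin.<? lookup π i)) (Vec.allFin _)
rlmin π = count (λ i → all? λ j → (i Fin.<? j) →-dec (lookup π i Fin.<? lookup π j)) (Vec.allFin _)

-- Coefficients of powers of x live in ℤ⟦ 6 ⟧, the power series in
-- p, q, u, v, s, t.
module Coefficients where
  open CommutativeRing ℤ⟦ 6 ⟧ public
  open Algebra.Properties.Semiring.Exp
    (CommutativeRing.semiring ℤ⟦ 6 ⟧) public using (_^_)

  p q u v s t : Carrier
  p = var 6 (# 0)
  q = var 6 (# 1)
  u = var 6 (# 2)
  v = var 6 (# 3)
  s = var 6 (# 4)
  t = var 6 (# 5)

  weight : Vec (Fin n) n → Carrier
  weight π = p ^ asc π * q ^ des π * u ^ lrmax π * v ^ rlmax π * s ^ lrmin π * t ^ rlmin π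

  sum : List Carrier → Carrier
  sum = List.foldr _+_ 0#

open PowerSeries ℤ⟦ 6 ⟧ public
  using ( Series; series; _/_
        ; 1-invertible; neg-invertible; +X-invertible; -X-invertible; *-invertible )
open CommutativeRing ℤ⟦ 7 ⟧ public using (_≈_; _+_; _*_; _-_; -_; 1#)
open Algebra.Properties.Semiring.Exp (CommutativeRing.semiring ℤ⟦ 7 ⟧) public using (_^_)

-- The sum over n of xⁿ times a series free of x, given by its coefficients.
F : Vec (Fin k) k → Vec (Fin m) m → Series
F τ ρ = series λ n → Coefficients.sum (List.map Coefficients.weight (S⟨ τ , ρ ⟩ n))

x p q u v s t : Series
x = var 7 (# 0)
p = var 7 (# 1)
q = var 7 (# 2)
u = var 7 (# 3)
v = var 7 (# 4)
s = var 7 (# 5)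
t = var 7 (# 6)

{-# OPTIONS --safe #-}

-- A permutation avoids 213 and 312 iff no entry has smaller value than an
-- entry on each of its sides. Its minimum is then the first or the last
-- entry, and deleting the minimum leaves a permutation of the same kind. A
-- new minimum in front of a nonempty π adds one ascent, one left-to-right
-- maximum and one right-to-left minimum, and makes lrmin equal to 1; the
-- mirror image holds for a new minimum at the back. So if x W(s,t) is the
-- part of F of positive degree in x, then
--   W(s,t) = uvst + x (pust W(1,t) + qvst W(s,1)),
-- and the instances at (1,1), (1,t), (s,1) and (s,t) form a triangular
-- linear system.

module Submission where

open import Algebra.Bundles using (CommutativeRing)
import Algebra.Properties.CommutativeSemigroup
import Algebra.Properties.Ring
import Algebra.Properties.Semiring.Exp
import Algebra.Solver.Ring.NaturalCoefficients.Default
open import Data.Bool.Base using (true; false)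
open import Data.Empty using (⊥-elim)
open import Data.Fin.Base using (Fin; zero; suc; inject₁; fromℕ; _≤_; _<_; toℕ; punchOut)
import Data.Fin.Properties as Fin
open import Data.Fin.Relation.Unary.Top using (view; ‵fromℕ; ‵inject₁)
open import Data.List.Base as List using (List; []; _∷_)
open import Data.List.Membership.Propositional using (_∈_)
open import Data.List.Membership.Propositional.Properties
  using (∈-filter⁺; ∈-filter⁻; ∈-++⁻; ∈-++⁺ˡ; ∈-++⁺ʳ; ∈-map⁻; ∈-map⁺)
open import Data.List.Membership.Propositional.Properties.WithK using (unique∧set⇒bag)
open import Data.List.Properties using (map-cong)
open import Data.List.Relation.Binary.BagAndSetEquality using (∼bag⇒↭)
open import Data.List.Relation.Binary.Permutation.Propositional as Perm using (_↭_)
open import Data.List.Relation.Unary.Unique.Propositional using () renaming (Unique to UniqueList)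
import Data.List.Relation.Unary.Unique.Propositional.Properties as List
open import Data.Nat.Base as ℕ using (ℕ; zero; suc; z<s; s<s; s<s⁻¹)
import Data.Nat.Properties as ℕ
open import Data.Product.Base using (∃-syntax; _×_; _,_)
open import Data.Sum.Base using (_⊎_; inj₁; inj₂)
open import Data.Vec.Base as Vec using (Vec; []; _∷_; _∷ʳ_; lookup; count; tabulate; allFin; initLast)
open import Data.Vec.Properties
  using (lookup-map; tabulate∘lookup; ∷-injectiveˡ; ∷-injectiveʳ; ∷ʳ-injectiveˡ)
open import Data.Vec.Relation.Unary.Unique.Propositional using (Unique)
import Data.Vec.Relation.Unary.Unique.Propositional.Properties as Vec
open import Defs
  using ( module PowerSeries; ℤ⟦_⟧; module Coefficients; S; S-unique; ∈-S⇔Unique; S⟨_,_⟩; Avoids; avoids?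
        ; IsOccurrence; [213]; [312]; asc; des; lrmax; lrmin; rlmax; rlmin )
open import Function.Base using (_∘_)
open import Function.Bundles using (_⇔_; mk⇔; Equivalence)
open import Function.Definitions using (Injective)
open import Level using (0ℓ)
open import Relation.Binary.Definitions using (tri<; tri≈; tri>)
open import Relation.Binary.PropositionalEquality as ≡
  using (_≡_; _≢_; cong; cong₂; subst; subst₂)
import Relation.Binary.Reasoning.Setoid
open import Relation.Nullary using (¬_; Dec; yes; no; does; contradiction; _×-dec_; _→-dec_)
open import Relation.Nullary.Decidable using (does-⇔)
open import Relation.Unary using (Pred; Decidable)

open Equivalence using (to; from)

private
  variable
    k m n : ℕ

-- Counting the entries of a word with a decidable property.

module _ {A : Set} where

  count-cong : {P Q : Pred A 0ℓ} (P? : Decidable P) (Q? : Decidable Q) →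
               (∀ a → P a ⇔ Q a) → (w : Vec A n) → count P? w ≡ count Q? w
  count-cong P? Q? P⇔Q []      = ≡.refl
  count-cong P? Q? P⇔Q (a ∷ w)
    rewrite does-⇔ (P⇔Q a) (P? a) (Q? a) | count-cong P? Q? P⇔Q w = ≡.refl

  count-none : {P : Pred A 0ℓ} (P? : Decidable P) →
               (∀ a → ¬ P a) → (w : Vec A n) → count P? w ≡ 0
  count-none P? ¬P []      = ≡.refl
  count-none P? ¬P (a ∷ w) with P? a
  ... | yes p = contradiction p (¬P a)
  ... | no  _ = count-none P? ¬P w

-- The tail of `allFin (suc n)` computes to `tabulate suc`, so every induction on positions has to
-- reindex a count in this way.
count-tabulate : {A : Set} {P : Pred A 0ℓ} (P? : Decidable P) (f : Fin n → A) →
                 count P? (tabulate f) ≡ count (P? ∘ f) (allFin n)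
count-tabulate {zero}  P? f = ≡.refl
count-tabulate {suc n} P? f
  rewrite count-tabulate P? (f ∘ suc) | count-tabulate (P? ∘ f) (suc {n}) = ≡.refl

-- The two ends of a word.

-- A slot is an end of a word at which a new letter can be inserted; old
-- embeds the original positions into those of the extended word.
record Slot (n : ℕ) : Set₁ where
  field
    new      : Fin (suc n)
    old      : Fin n → Fin (suc n)
    cover    : {P : Fin (suc n) → Set} → P new → (∀ i → P (old i)) → ∀ i → P i
    old-<    : ∀ {i j} → i < j ⇔ old i < old j
    old-inj  : ∀ {i j} → old i ≡ old j → i ≡ j
    extreme  : (i j : Fin (suc n)) → i < new → ¬ new < j
    count-∋  : {P : Pred (Fin (suc n)) 0ℓ} (P? : Decidable P) → P new →
               count P? (allFin (suc n)) ≡ suc (count (P? ∘ old) (allFin n))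
    count-∌  : {P : Pred (Fin (suc n)) 0ℓ} (P? : Decidable P) → ¬ P new →
               count P? (allFin (suc n)) ≡ count (P? ∘ old) (allFin n)

front : ∀ n → Slot n
front n = record
  { new     = zero
  ; old     = suc
  ; cover   = λ { p q zero → p ; p q (suc i) → q i }
  ; old-<   = mk⇔ s<s s<s⁻¹
  ; old-inj = Fin.suc-injective
  ; extreme = λ _ _ ()
  ; count-∋ = count-∋
  ; count-∌ = count-∌
  }
  where
  count-∋ : {P : Pred (Fin (suc n)) 0ℓ} (P? : Decidable P) → P zero →
            count P? (allFin (suc n)) ≡ suc (count (P? ∘ suc) (allFin n))
  count-∋ P? p with P? zero
  ... | yes _ = cong suc (count-tabulate P? suc)
  ... | no ¬p = contradiction p ¬p

  count-∌ : {P : Pred (Fin (suc n)) 0ℓ} (P? : Decidable P) → ¬ P zero →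
            count P? (allFin (suc n)) ≡ count (P? ∘ suc) (allFin n)
  count-∌ P? ¬p with P? zero
  ... | yes p = contradiction p ¬p
  ... | no  _ = count-tabulate P? suc

inject₁-< : {i j : Fin n} → i < j ⇔ inject₁ i < inject₁ j
inject₁-< {i = i} {j} = mk⇔
  (subst₂ ℕ._<_ (≡.sym (Fin.toℕ-inject₁ i)) (≡.sym (Fin.toℕ-inject₁ j)))
  (subst₂ ℕ._<_ (Fin.toℕ-inject₁ i) (Fin.toℕ-inject₁ j))

inject₁<fromℕ : (i : Fin n) → inject₁ i < fromℕ n
inject₁<fromℕ {n} i = subst (toℕ (inject₁ i) ℕ.<_) (≡.sym (Fin.toℕ-fromℕ n)) (Fin.inject₁ℕ< i)

fromℕ≮ : (i : Fin (suc n)) → ¬ fromℕ n < i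
fromℕ≮ i = ℕ.≤⇒≯ (Fin.≤fromℕ i)

back : ∀ n → Slot n
back n = record
  { new     = fromℕ n
  ; old     = inject₁
  ; cover   = cover
  ; old-<   = inject₁-<
  ; old-inj = Fin.inject₁-injective
  ; extreme = λ _ j _ → fromℕ≮ j
  ; count-∋ = count-∋ n
  ; count-∌ = count-∌ n
  }
  where
  cover : {P : Fin (suc n) → Set} → P (fromℕ n) → (∀ i → P (inject₁ i)) → ∀ i → P i
  cover p q i with view i
  ... | ‵fromℕ     = p
  ... | ‵inject₁ j = q j

  count-∋ : ∀ n {P : Pred (Fin (suc n)) 0ℓ} (P? : Decidable P) → P (fromℕ n) →
            count P? (allFin (suc n)) ≡ suc (count (P? ∘ inject₁) (allFin n))
  -- On a single position, front and back are the same slot.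
  count-∋ zero    P? p = Slot.count-∋ (front 0) P? p
  -- The first position is old on both sides of the equation, so it is split off and the induction
  -- runs on the rest.
  count-∋ (suc n) P? p
    rewrite count-tabulate P? suc | count-tabulate (P? ∘ inject₁) (suc {n})
          | count-∋ n (P? ∘ suc) p with does (P? zero)
  ... | true  = ≡.refl
  ... | false = ≡.refl

  count-∌ : ∀ n {P : Pred (Fin (suc n)) 0ℓ} (P? : Decidable P) → ¬ P (fromℕ n) →
            count P? (allFin (suc n)) ≡ count (P? ∘ inject₁) (allFin n)
  count-∌ zero    P? ¬p = Slot.count-∌ (front 0) P? ¬p
  count-∌ (suc n) P? ¬p
    rewrite count-tabulate P? suc | count-tabulate (P? ∘ inject₁) (suc {n})
          | count-∌ n (P? ∘ suc) ¬p = ≡.refl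

-- Unimodal words, steps and records.

NoValley : Vec (Fin m) k → Set
NoValley w = ∀ {i j l} → i < j → j < l → ¬ (lookup w j < lookup w i × lookup w j < lookup w l)

-- For `m = k` these are the permutations that rise to their maximum and then fall.
Unimodal : Vec (Fin m) k → Set
Unimodal w = Injective _≡_ _≡_ (lookup w) × NoValley w

-- The same type orders positions (the side from which a word is read) and values (maxima or
-- minima), so that one argument covers all four record statistics.
data Direction : Set where
  up down : Direction

_<[_]_ : Fin k → Direction → Fin k → Set
i <[ up   ] j = i < j
i <[ down ] j = j < i

_<[_]?_ : (i : Fin k) (d : Direction) (j : Fin k) → Dec (i <[ d ] j)
i <[ up   ]? j = i Fin.<? j
i <[ down ]? j = j Fin.<? i

<[]-asym : ∀ d {i j : Fin k} → i <[ d ] j → ¬ j <[ d ] i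
<[]-asym up   = Fin.<-asym
<[]-asym down = Fin.<-asym

<[]-cong : {i j : Fin k} {a b : Fin m} → i < j ⇔ a < b → j < i ⇔ b < a →
           ∀ d → i <[ d ] j ⇔ a <[ d ] b
<[]-cong e f up   = e
<[]-cong e f down = f

step? : ∀ e (w : Vec (Fin m) (suc k)) i → Dec (lookup w (inject₁ i) <[ e ] lookup w (suc i))
step? e w i = lookup w (inject₁ i) <[ e ]? lookup w (suc i)

-- On nonempty words `steps up` and `steps down` unfold to `asc` and `des`.
steps : Direction → Vec (Fin m) (suc k) → ℕ
steps e w = count (step? e w) (allFin _)

IsRecord : Direction → Direction → Vec (Fin m) k → Fin k → Set
IsRecord d e w i = ∀ j → j <[ d ] i → lookup w j <[ e ] lookup w i

record? : ∀ d e (w : Vec (Fin m) k) i → Dec (IsRecord d e w i)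
record? d e w i = Fin.all? λ j → (j <[ d ]? i) →-dec (lookup w j <[ e ]? lookup w i)

-- lrmax, lrmin, rlmax and rlmin are records d e for the four choices of d and e.
records : Direction → Direction → Vec (Fin m) k → ℕ
records d e w = count (record? d e w) (allFin _)

-- Inserting a new minimum at an end of a word.

module Insertion (slot : Slot n) (π : Vec (Fin m) n) (w : Vec (Fin (suc m)) (suc n))
  (lookup-old : ∀ i → lookup w (Slot.old slot i) ≡ suc (lookup π i))
  (lookup-new : lookup w (Slot.new slot) ≡ zero)
  where

  open Slot slot

  lookup-old-< : ∀ {i j} → lookup π i < lookup π j ⇔ lookup w (old i) < lookup w (old j)
  lookup-old-< {i} {j} = mk⇔
    (λ lt → subst₂ _<_ (≡.sym (lookup-old i)) (≡.sym (lookup-old j)) (s<s lt))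
    (λ lt → s<s⁻¹ (subst₂ _<_ (lookup-old i) (lookup-old j) lt))

  new-least : ∀ i → lookup w new < lookup w (old i)
  new-least i = subst₂ _<_ (≡.sym lookup-new) (≡.sym (lookup-old i)) z<s

  ≮new : ∀ i → ¬ lookup w i < lookup w new
  ≮new i lt = contradiction (subst (lookup w i <_) lookup-new lt) λ ()

  -- The new letter lies on no valley of `w`: it is too small to be an outer letter, and at an end
  -- of the word it cannot be the bottom.
  unimodal : Unimodal w ⇔ Unimodal π
  unimodal = mk⇔ restrict extend
    where
    restrict : Unimodal w → Unimodal π
    restrict (inj , valley) =
      (λ {i} {j} eq → old-inj (inj (≡.trans (lookup-old i) (≡.trans (cong suc eq) (≡.sym (lookup-old j))))))
      , λ i<j j<l (ji , jl) →
          valley (to old-< i<j) (to old-< j<l) (to lookup-old-< ji , to lookup-old-< jl)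

    old≢new : ∀ i → lookup w (old i) ≢ lookup w new
    old≢new i eq = Fin.<-irrefl (≡.sym eq) (new-least i)

    extend : Unimodal π → Unimodal w
    extend (inj , valley) = (λ {i} {j} → w-inj i j) , λ {i} {j} {l} → w-valley i j l
      where
      w-inj : ∀ i j → lookup w i ≡ lookup w j → i ≡ j
      w-inj = cover (cover (λ _ → ≡.refl) λ j eq → contradiction (≡.sym eq) (old≢new j))
        λ i → cover (λ eq → contradiction eq (old≢new i)) λ j eq →
          cong old (inj (Fin.suc-injective (≡.trans (≡.sym (lookup-old i)) (≡.trans eq (lookup-old j)))))

      w-valley : ∀ i j l → i < j → j < l → ¬ (lookup w j < lookup w i × lookup w j < lookup w l)
      w-valley i = cover (λ l i<z z<l _ → extreme i l i<z z<l) λ j → valley-at i j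
        where
        valley-at : ∀ i j l → i < old j → old j < l →
                    ¬ (lookup w (old j) < lookup w i × lookup w (old j) < lookup w l)
        valley-at = cover (λ j l _ _ (lt , _) → ≮new (old j) lt) λ i j →
          cover (λ _ _ (_ , lt) → ≮new (old j) lt) λ l i<j j<l (ji , jl) →
            valley (from old-< i<j) (from old-< j<l) (from lookup-old-< ji , from lookup-old-< jl)

  new<[_]old old<[_]new : Direction → Set
  new<[ d ]old = ∀ i → new <[ d ] old i
  old<[ d ]new = ∀ i → old i <[ d ] new

  module Records (d e : Direction) where

    private
      ≺-asym : {i j : Fin (suc n)} → i <[ d ] j → ¬ j <[ d ] i
      ≺-asym = <[]-asym d
      ⊏-asym : {i j : Fin (suc m)} → i <[ e ] j → ¬ j <[ e ] i
      ⊏-asym = <[]-asym e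
      old-≺  = λ {i} {j} → <[]-cong (old-< {i} {j}) old-< d
      old-⊏  = λ {i} {j} → <[]-cong (lookup-old-< {i} {j}) lookup-old-< e

      -- Both refer to the order `e` on values: for `e = down` the new minimum is the greatest
      -- letter.
      least greatest : Set
      least    = ∀ i → lookup w new <[ e ] lookup w (old i)
      greatest = ∀ i → lookup w (old i) <[ e ] lookup w new

      -- Old letters compare among themselves as before, so only the new letter could spoil an old
      -- record; the hypothesis says that it never does.
      keep : (∀ i → new <[ d ] old i → lookup w new <[ e ] lookup w (old i)) →
             ∀ i → IsRecord d e w (old i) ⇔ IsRecord d e π i
      keep h i = mk⇔
        (λ r j j≺i → from old-⊏ (r (old j) (to old-≺ j≺i)))
        (λ r → cover (h i) λ j j≺i → to old-⊏ (r j (from old-≺ j≺i)))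

      first⇒record : new<[ d ]old → IsRecord d e w new
      first⇒record first = cover
        (λ z≺z → ⊥-elim (≺-asym {new} {new} z≺z z≺z))
        λ i i≺z → ⊥-elim (≺-asym {old i} {new} i≺z (first i))

      w? = record? d e w
      π? = record? d e π

    -- The letter read first is vacuously a record, and a least letter obstructs no later one.
    first-least : new<[ d ]old → least → records d e w ≡ suc (records d e π)
    first-least first lst = ≡.trans (count-∋ w? (first⇒record first))
      (cong suc (count-cong (w? ∘ old) π? (keep λ i _ → lst i) (allFin _)))

    -- The greatest letter, read first, leaves no room for another record.
    first-greatest : new<[ d ]old → greatest → records d e w ≡ 1
    first-greatest first grt = ≡.trans (count-∋ w? (first⇒record first))
      (cong suc (count-none (w? ∘ old)
        (λ i r → ⊏-asym {lookup w new} {lookup w (old i)} (r new (first i)) (grt i)) (allFin _)))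

    -- The argument in `Fin n` provides an old letter that beats the new one. Over an empty `π` the
    -- new letter would be a record.
    last-least : Fin n → old<[ d ]new → least → records d e w ≡ records d e π
    last-least i last lst = ≡.trans
      (count-∌ w? λ r → ⊏-asym {lookup w (old i)} {lookup w new} (r (old i) (last i)) (lst i))
      (count-cong (w? ∘ old) π? (keep λ i _ → lst i) (allFin _))

    -- The new letter beats everything read before it and comes too late to affect the old records.
    last-greatest : old<[ d ]new → greatest → records d e w ≡ suc (records d e π)
    last-greatest last grt =
      ≡.trans (count-∋ w? (cover (λ z≺z → ⊥-elim (≺-asym {new} {new} z≺z z≺z)) λ i _ → grt i))
        (cong suc (count-cong (w? ∘ old) π?
          (keep λ i z≺i → ⊥-elim (≺-asym {new} {old i} z≺i (last i))) (allFin _)))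

-- The six statistics after prepending or appending a minimum.

shift : Vec (Fin m) k → Vec (Fin (suc m)) k
shift = Vec.map suc

prepend append : Vec (Fin m) k → Vec (Fin (suc m)) (suc k)
prepend π = zero ∷ shift π
append  π = shift π ∷ʳ zero

module _ {A : Set} where

  lookup-∷ʳ-inject₁ : (w : Vec A k) (a : A) (i : Fin k) → lookup (w ∷ʳ a) (inject₁ i) ≡ lookup w i
  lookup-∷ʳ-inject₁ (b ∷ w) a zero    = ≡.refl
  lookup-∷ʳ-inject₁ (b ∷ w) a (suc i) = lookup-∷ʳ-inject₁ w a i

  lookup-∷ʳ-fromℕ : (w : Vec A k) (a : A) → lookup (w ∷ʳ a) (fromℕ k) ≡ a
  lookup-∷ʳ-fromℕ []      a = ≡.refl
  lookup-∷ʳ-fromℕ (b ∷ w) a = lookup-∷ʳ-fromℕ w a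

lookup-append : (π : Vec (Fin m) k) (i : Fin k) → lookup (append π) (inject₁ i) ≡ suc (lookup π i)
lookup-append π i = ≡.trans (lookup-∷ʳ-inject₁ (shift π) zero i) (lookup-map i suc π)

module Prepend (π : Vec (Fin m) (suc k)) where

  open Insertion (front (suc k)) π (prepend π) (λ i → lookup-map i suc π) ≡.refl public

  private
    step-old : ∀ e i → _ ⇔ _
    step-old e i = <[]-cong (lookup-old-< {inject₁ i} {suc i}) lookup-old-< e

    steps-old : ∀ e → count (step? e (prepend π) ∘ suc) (allFin k) ≡ steps e π
    steps-old e = count-cong (step? e (prepend π) ∘ suc) (step? e π)
      (λ i → mk⇔ (from (step-old e i)) (to (step-old e i))) (allFin k)

  -- There is one step fewer than letters, so steps use the slot of size `k` and letters the slot of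
  -- size `suc k`. The new step leads from the minimum up to the old first letter.
  asc-prepend : asc (prepend π) ≡ suc (asc π)
  asc-prepend = ≡.trans (Slot.count-∋ (front k) (step? up (prepend π)) (new-least zero))
    (cong suc (steps-old up))

  des-prepend : des (prepend π) ≡ des π
  des-prepend = ≡.trans (Slot.count-∌ (front k) (step? down (prepend π)) (≮new (suc zero)))
    (steps-old down)

  lrmax-prepend : lrmax (prepend π) ≡ suc (lrmax π)
  lrmax-prepend = Records.first-least up up (λ _ → z<s) new-least

  lrmin-prepend : lrmin (prepend π) ≡ 1
  lrmin-prepend = Records.first-greatest up down (λ _ → z<s) new-least

  -- Read from the right, the front letter comes last; `zero` is an old letter that beats it.
  rlmax-prepend : rlmax (prepend π) ≡ rlmax π
  rlmax-prepend = Records.last-least down up zero (λ _ → z<s) new-least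

  rlmin-prepend : rlmin (prepend π) ≡ suc (rlmin π)
  rlmin-prepend = Records.last-greatest down down (λ _ → z<s) new-least

module Append (π : Vec (Fin m) (suc k)) where

  open Insertion (back (suc k)) π (append π) (lookup-append π)
    (lookup-∷ʳ-fromℕ (shift π) zero) public

  private
    step-old : ∀ e i → _ ⇔ _
    step-old e i = <[]-cong (lookup-old-< {inject₁ i} {suc i}) lookup-old-< e

    -- `inject₁ (suc i)` computes to `suc (inject₁ i)`, so injecting a step injects both of its
    -- letters.
    steps-old : ∀ e → count (step? e (append π) ∘ inject₁) (allFin k) ≡ steps e π
    steps-old e = count-cong (step? e (append π) ∘ inject₁) (step? e π)
      (λ i → mk⇔ (from (step-old e i)) (to (step-old e i))) (allFin k)

  asc-append : asc (append π) ≡ asc π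
  asc-append = ≡.trans (Slot.count-∌ (back k) (step? up (append π)) (≮new (inject₁ (fromℕ k))))
    (steps-old up)

  -- The new step is the last one, from the old last letter at `inject₁ (fromℕ k)` down to the
  -- minimum.
  des-append : des (append π) ≡ suc (des π)
  des-append = ≡.trans (Slot.count-∋ (back k) (step? down (append π)) (new-least (fromℕ k)))
    (cong suc (steps-old down))

  lrmax-append : lrmax (append π) ≡ lrmax π
  lrmax-append = Records.last-least up up zero inject₁<fromℕ new-least

  lrmin-append : lrmin (append π) ≡ suc (lrmin π)
  lrmin-append = Records.last-greatest up down inject₁<fromℕ new-least

  rlmax-append : rlmax (append π) ≡ suc (rlmax π)
  rlmax-append = Records.first-least down up inject₁<fromℕ new-least

  -- Read from the right, the minimum comes first and rules out every other right-to-left minimum.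
  rlmin-append : rlmin (append π) ≡ 1
  rlmin-append = Records.first-greatest down down inject₁<fromℕ new-least

-- Avoiding 213 and 312 as the absence of valleys.

both : {A B : Set} → A → B → A ⇔ B
both a b = mk⇔ (λ _ → b) (λ _ → a)

neither : {A B : Set} → ¬ A → ¬ B → A ⇔ B
neither ¬a ¬b = mk⇔ (λ a → contradiction a ¬a) (λ b → contradiction b ¬b)

module _ (π : Vec (Fin n) n) {i j l : Fin n} (i<j : i < j) (j<l : j < l) where

  private
    positions : ∀ a b → a < b → lookup (i ∷ j ∷ l ∷ []) a < lookup (i ∷ j ∷ l ∷ []) b
    positions zero             (suc zero)       _ = i<j
    positions zero             (suc (suc zero)) _ = Fin.<-trans i<j j<l
    positions (suc zero)       (suc (suc zero)) _ = j<l
    positions (suc zero)       (suc zero)       1<1 = contradiction 1<1 (ℕ.<-irrefl ≡.refl)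
    positions (suc (suc zero)) (suc (suc zero)) 2<2 = contradiction 2<2 (ℕ.<-irrefl ≡.refl)
    positions (suc (suc zero)) (suc zero)       2<1 = contradiction 2<1 λ { (s<s ()) }

    irr : ∀ {a} → ¬ lookup π a < lookup π a
    irr = Fin.<-irrefl ≡.refl

    as : ∀ {a b} → lookup π a < lookup π b → ¬ lookup π b < lookup π a
    as = Fin.<-asym

    pattern 0F = zero
    pattern 1F = suc zero
    pattern 2F = suc (suc zero)

  occurrence-213 : lookup π j < lookup π i → lookup π i < lookup π l →
                   IsOccurrence [213] π (i ∷ j ∷ l ∷ [])
  occurrence-213 ji il = positions , values
    where
    values : ∀ a b → _ ⇔ _
    values 0F 0F = neither irr (ℕ.<-irrefl ≡.refl)
    values 0F 1F = neither (as ji) λ ()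
    values 0F 2F = both il (s<s z<s)
    values 1F 0F = both ji z<s
    values 1F 1F = neither irr (ℕ.<-irrefl ≡.refl)
    values 1F 2F = both (Fin.<-trans ji il) z<s
    values 2F 0F = neither (as il) λ { (s<s ()) }
    values 2F 1F = neither (as (Fin.<-trans ji il)) λ ()
    values 2F 2F = neither irr (ℕ.<-irrefl ≡.refl)

  occurrence-312 : lookup π j < lookup π l → lookup π l < lookup π i →
                   IsOccurrence [312] π (i ∷ j ∷ l ∷ [])
  occurrence-312 jl li = positions , values
    where
    values : ∀ a b → _ ⇔ _
    values 0F 0F = neither irr (ℕ.<-irrefl ≡.refl)
    values 0F 1F = neither (as (Fin.<-trans jl li)) λ ()
    values 0F 2F = neither (as li) λ { (s<s ()) }
    values 1F 0F = both (Fin.<-trans jl li) z<s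
    values 1F 1F = neither irr (ℕ.<-irrefl ≡.refl)
    values 1F 2F = both jl z<s
    values 2F 0F = both li (s<s z<s)
    values 2F 1F = neither (as jl) λ ()
    values 2F 2F = neither irr (ℕ.<-irrefl ≡.refl)

-- An occurrence of a pattern whose middle letter is smallest is a valley; 213 and 312 are both of
-- this kind.
no-valley⇒avoids : (π : Vec (Fin n) n) → NoValley π → (τ : Vec (Fin 3) 3) →
                   lookup τ (suc zero) < lookup τ zero →
                   lookup τ (suc zero) < lookup τ (suc (suc zero)) → Avoids τ π
no-valley⇒avoids π no-valley τ τ₁<τ₀ τ₁<τ₂ (_ , mono , iso) =
  no-valley (mono zero (suc zero) z<s) (mono (suc zero) (suc (suc zero)) (s<s z<s))
    (from (iso (suc zero) zero) τ₁<τ₀ , from (iso (suc zero) (suc (suc zero))) τ₁<τ₂)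

∈-S⟨⟩⇔Unimodal : (π : Vec (Fin n) n) → π ∈ S⟨ [213] , [312] ⟩ n ⇔ Unimodal π
∈-S⟨⟩⇔Unimodal {n} π = mk⇔ unimodal member
  where
  avoids-both? = λ (w : Vec (Fin n) n) → avoids? [213] w ×-dec avoids? [312] w

  unimodal : π ∈ S⟨ [213] , [312] ⟩ n → Unimodal π
  unimodal π∈ with ∈-filter⁻ avoids-both? {xs = S n} π∈
  ... | π∈S , av₁ , av₂ = inj , no-valley
    where
    inj : Injective _≡_ _≡_ (lookup π)
    inj = Vec.lookup-injective (to (∈-S⇔Unique π) π∈S) _ _

    no-valley : NoValley π
    -- The order of the two outer letters decides which of the patterns the valley shows.
    no-valley {i} {j} {l} i<j j<l (ji , jl) with Fin.<-cmp (lookup π i) (lookup π l)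
    ... | tri< il _ _ = av₁ (i ∷ j ∷ l ∷ [] , occurrence-213 π i<j j<l ji il)
    ... | tri≈ _ il _ = Fin.<-irrefl (inj il) (Fin.<-trans i<j j<l)
    ... | tri> _ _ li = av₂ (i ∷ j ∷ l ∷ [] , occurrence-312 π i<j j<l jl li)

  member : Unimodal π → π ∈ S⟨ [213] , [312] ⟩ n
  member (inj , no-valley) = ∈-filter⁺ avoids-both?
    (from (∈-S⇔Unique π) (subst Unique (tabulate∘lookup π) (Vec.tabulate⁺ inj)))
    (no-valley⇒avoids π no-valley [213] z<s z<s , no-valley⇒avoids π no-valley [312] z<s z<s)

-- Decomposing unimodal permutations by the place of the minimum.

zero-occurs : (π : Vec (Fin (suc n)) (suc n)) → Injective _≡_ _≡_ (lookup π) →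
              ∃[ i ] lookup π i ≡ zero
zero-occurs π inj with Fin.any? (λ i → lookup π i Fin.≟ zero)
... | yes p = p
-- Pigeonhole: if zero were missed, punching it out would inject `suc n` positions into `n` values.
... | no ¬p = contradiction (Fin.injective⇒≤ {f = λ i → punchOut (0≢ i)}
                λ {i} {j} eq → inj (Fin.punchOut-injective (0≢ i) (0≢ j) eq)) ℕ.1+n≰n
  where
  0≢ : ∀ i → zero ≢ lookup π i
  0≢ i eq = ¬p (i , ≡.sym eq)

shift⁻¹ : (w : Vec (Fin (suc m)) k) → (∀ i → lookup w i ≢ zero) → ∃[ π ] w ≡ shift π
shift⁻¹ []          _  = [] , ≡.refl
shift⁻¹ (zero ∷ w)  ≢0 = contradiction ≡.refl (≢0 zero)
shift⁻¹ (suc a ∷ w) ≢0 with shift⁻¹ w (≢0 ∘ suc)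
... | π , ≡.refl = a ∷ π , ≡.refl

-- A minimum in the interior would form a valley with the first and the last letter. When it is at
-- an end, injectivity keeps zero out of the other letters, which can then all be lowered by one.
unimodal-split : (w : Vec (Fin (suc n)) (suc n)) → Unimodal w →
                 (∃[ π ] w ≡ prepend π) ⊎ (∃[ π ] w ≡ append π)
unimodal-split {n} w (inj , no-valley) with zero-occurs w inj
... | i , wᵢ≡0 with i Fin.≟ zero | i Fin.≟ fromℕ n
unimodal-split (a ∷ w) (inj , _) | _ , ≡.refl | yes ≡.refl | _
  with shift⁻¹ w (λ i wᵢ≡0 → Fin.0≢1+n (inj (≡.sym wᵢ≡0)))
... | π , ≡.refl = inj₁ (π , ≡.refl)
-- The letter that `initLast` splits off sits at `fromℕ n`, hence it is the zero.
unimodal-split w (inj , _) | _ , wᵢ≡0 | no _ | yes ≡.refl with initLast w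
... | w′ , a , ≡.refl with ≡.trans (≡.sym (lookup-∷ʳ-fromℕ w′ a)) wᵢ≡0
... | ≡.refl with shift⁻¹ w′ (λ i eq → Fin.fromℕ≢inject₁
                  (inj (≡.trans wᵢ≡0 (≡.sym (≡.trans (lookup-∷ʳ-inject₁ w′ a i) eq)))))
... | π , ≡.refl = inj₂ (π , ≡.refl)
unimodal-split {n} w (inj , no-valley) | i , wᵢ≡0 | no i≢0 | no i≢n =
  contradiction (below zero (i≢0 ∘ ≡.sym) , below (fromℕ n) (i≢n ∘ ≡.sym))
    (no-valley (Fin.≤∧≢⇒< ℕ.z≤n (i≢0 ∘ ≡.sym)) (Fin.≤∧≢⇒< (Fin.≤fromℕ i) i≢n))
  where
  below : ∀ j → j ≢ i → lookup w i < lookup w j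
  below j j≢i = Fin.≤∧≢⇒< (subst (_≤ lookup w j) (≡.sym wᵢ≡0) ℕ.z≤n) (λ eq → j≢i (inj (≡.sym eq)))

shift-injective : (π ρ : Vec (Fin m) k) → shift π ≡ shift ρ → π ≡ ρ
shift-injective []      []      _  = ≡.refl
shift-injective (_ ∷ π) (_ ∷ ρ) eq =
  cong₂ _∷_ (Fin.suc-injective (∷-injectiveˡ eq)) (shift-injective π ρ (∷-injectiveʳ eq))

prepend-injective : (π ρ : Vec (Fin m) k) → prepend π ≡ prepend ρ → π ≡ ρ
prepend-injective π ρ eq = shift-injective π ρ (∷-injectiveʳ eq)

append-injective : (π ρ : Vec (Fin m) k) → append π ≡ append ρ → π ≡ ρ
append-injective π ρ eq = shift-injective π ρ (∷ʳ-injectiveˡ _ _ eq)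

-- The first letter is zero on one side and a successor on the other. Length `suc k` excludes the
-- empty word, for which both insertions agree.
prepend≢append : (π ρ : Vec (Fin m) (suc k)) → prepend π ≢ append ρ
prepend≢append π (b ∷ ρ) ()

-- Lists without repetitions and with the same members are permutations of each other, so uniqueness
-- reduces the claim to a comparison of members.
unimodal-↭ : {L : List (Vec (Fin (suc n)) (suc n))} {M : List (Vec (Fin (2 ℕ.+ n)) (2 ℕ.+ n))} →
             UniqueList L → UniqueList M →
             (∀ π → π ∈ L ⇔ Unimodal π) → (∀ w → w ∈ M ⇔ Unimodal w) →
             M ↭ List.map prepend L List.++ List.map append L
unimodal-↭ {n} {L} {M} L! M! L-spec M-spec = ∼bag⇒↭ (unique∧set⇒bag M!
  (List.++⁺ (List.map⁺ (prepend-injective _ _) L!) (List.map⁺ (append-injective _ _) L!) disjoint)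
  (mk⇔ split join))
  where
  disjoint : ∀ {w} → ¬ (w ∈ List.map prepend L × w ∈ List.map append L)
  disjoint (p , q) with ∈-map⁻ prepend p | ∈-map⁻ append q
  ... | π , _ , ≡.refl | ρ , _ , eq = prepend≢append π ρ eq

  split : ∀ {w} → w ∈ M → w ∈ List.map prepend L List.++ List.map append L
  split {w} w∈ with to (M-spec w) w∈
  ... | uni with unimodal-split w uni
  ... | inj₁ (π , ≡.refl) = ∈-++⁺ˡ (∈-map⁺ prepend (from (L-spec π) (to (Prepend.unimodal π) uni)))
  ... | inj₂ (π , ≡.refl) = ∈-++⁺ʳ _ (∈-map⁺ append (from (L-spec π) (to (Append.unimodal π) uni)))

  join : ∀ {w} → w ∈ List.map prepend L List.++ List.map append L → w ∈ M
  join {w} w∈ with ∈-++⁻ (List.map prepend L) w∈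
  ... | inj₁ p with ∈-map⁻ prepend p
  ...   | π , π∈ , ≡.refl = from (M-spec w) (from (Prepend.unimodal π) (to (L-spec π) π∈))
  join {w} w∈ | inj₂ p with ∈-map⁻ append p
  ...   | π , π∈ , ≡.refl = from (M-spec w) (from (Append.unimodal π) (to (L-spec π) π∈))

S⟨⟩-suc : ∀ n → S⟨ [213] , [312] ⟩ (2 ℕ.+ n) ↭
          List.map prepend (S⟨ [213] , [312] ⟩ (suc n)) List.++
          List.map append (S⟨ [213] , [312] ⟩ (suc n))
S⟨⟩-suc n = unimodal-↭ (unique (suc n)) (unique (2 ℕ.+ n)) ∈-S⟨⟩⇔Unimodal ∈-S⟨⟩⇔Unimodal
  where
  unique : ∀ n → UniqueList (S⟨ [213] , [312] ⟩ n)
  unique n = List.filter⁺ (λ w → avoids? [213] w ×-dec avoids? [312] w) (S-unique n)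

-- The recursion for the weighted sums.

module Weights {c ℓ} (R : CommutativeRing c ℓ) (p q u v : CommutativeRing.Carrier R) where

  open CommutativeRing R
  open Algebra.Properties.Semiring.Exp semiring using (_^_)
  open Algebra.Properties.CommutativeSemigroup +-commutativeSemigroup using (x∙yz≈y∙xz)
  open Algebra.Solver.Ring.NaturalCoefficients.Default commutativeSemiring
  open Relation.Binary.Reasoning.Setoid setoid

  sum : List Carrier → Carrier
  sum = List.foldr _+_ 0#

  module _ {A : Set} where

    sum-↭ : (f : A → Carrier) {as bs : List A} → as ↭ bs →
            sum (List.map f as) ≈ sum (List.map f bs)
    sum-↭ f Perm.refl         = refl
    sum-↭ f (Perm.prep a r)   = +-congˡ (sum-↭ f r)
    sum-↭ f (Perm.swap a b r) = trans (+-congˡ (+-congˡ (sum-↭ f r))) (x∙yz≈y∙xz _ _ _)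
    sum-↭ f (Perm.trans r r′) = trans (sum-↭ f r) (sum-↭ f r′)

    sum-++ : (f : A → Carrier) (as bs : List A) →
             sum (List.map f (as List.++ bs)) ≈ sum (List.map f as) + sum (List.map f bs)
    sum-++ f []       bs = sym (+-identityˡ _)
    sum-++ f (a ∷ as) bs = trans (+-congˡ (sum-++ f as bs)) (sym (+-assoc _ _ _))

    sum-scale : {B : Set} {f : A → Carrier} {g : B → Carrier} (h : B → A) (y : Carrier) →
                (∀ b → f (h b) ≈ y * g b) → (bs : List B) →
                sum (List.map f (List.map h bs)) ≈ y * sum (List.map g bs)
    sum-scale h y f∘h []       = sym (zeroʳ y)
    sum-scale h y f∘h (b ∷ bs) =
      trans (+-cong (f∘h b) (sum-scale h y f∘h bs)) (sym (distribˡ y _ _))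

  -- Only `s` and `t` are arguments, because the recursion specialises these two to one.
  weight : Carrier → Carrier → Vec (Fin m) k → Carrier
  weight s t π = p ^ asc π * q ^ des π * u ^ lrmax π * v ^ rlmax π * s ^ lrmin π * t ^ rlmin π

  1^ : ∀ n → 1# ^ n ≈ 1#
  1^ zero    = refl
  1^ (suc n) = trans (*-identityˡ _) (1^ n)

  -- Prepending resets `lrmin` to one, so its old value has to be forgotten; evaluating the weight
  -- of `π` at `s = 1` does this.
  weight-prepend : ∀ s t (π : Vec (Fin m) (suc k)) →
                   weight s t (prepend π) ≈ p * u * s * t * weight 1# t π
  weight-prepend s t π
    rewrite Prepend.asc-prepend π | Prepend.des-prepend π | Prepend.lrmax-prepend π
          | Prepend.rlmax-prepend π | Prepend.lrmin-prepend π | Prepend.rlmin-prepend π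
    = trans
        -- Within the polynomial, `q` and `v` stand for the unchanged powers `q ^ des π` and
        -- `v ^ rlmax π`.
        (solve 9 (λ p a q u b v s t d →
            (p :* a) :* q :* (u :* b) :* v :* s :^ 1 :* (t :* d)
            := p :* u :* s :* t :* (a :* q :* b :* v :* d))
          refl p (p ^ asc π) (q ^ des π) u (u ^ lrmax π) (v ^ rlmax π) s t (t ^ rlmin π))
        -- This restores the factor `1# ^ lrmin π` of `weight 1# t π`.
        (*-congˡ (*-congʳ (sym (trans (*-congˡ (1^ (lrmin π))) (*-identityʳ _)))))

  weight-append : ∀ s t (π : Vec (Fin m) (suc k)) →
                  weight s t (append π) ≈ q * v * s * t * weight s 1# π
  weight-append s t π
    rewrite Append.asc-append π | Append.des-append π | Append.lrmax-append π
          | Append.rlmax-append π | Append.lrmin-append π | Append.rlmin-append π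
    = trans
        (solve 9 (λ p q a u v b s d t →
            p :* (q :* a) :* u :* (v :* b) :* (s :* d) :* t :^ 1
            := q :* v :* s :* t :* (p :* a :* u :* b :* d))
          refl (p ^ asc π) q (q ^ des π) (u ^ lrmax π) v (v ^ rlmax π) s (s ^ lrmin π) t)
        (*-congˡ (sym (trans (*-congˡ (1^ (rlmin π))) (*-identityʳ _))))

  total : Carrier → Carrier → ℕ → Carrier
  total s t n = sum (List.map (weight s t) (S⟨ [213] , [312] ⟩ n))

  -- Here and in `total-1` the list of avoiders evaluates to a single word, leaving an identity for
  -- the solver.
  total-0 : ∀ s t → total s t 0 ≈ 1#
  total-0 s t = solve 0
    (con 1 :* con 1 :* con 1 :* con 1 :* con 1 :* con 1 :+ con 0 := con 1) refl

  total-1 : ∀ s t → total s t 1 ≈ u * v * s * t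
  total-1 s t = solve 4 (λ u v s t →
    con 1 :* con 1 :* u :^ 1 :* v :^ 1 :* s :^ 1 :* t :^ 1 :+ con 0 := u :* v :* s :* t)
    refl u v s t

  total-suc : ∀ s t n → total s t (2 ℕ.+ n) ≈
              p * u * s * t * total 1# t (suc n) + q * v * s * t * total s 1# (suc n)
  total-suc s t n = begin
    total s t (2 ℕ.+ n)
      ≈⟨ sum-↭ (weight s t) (S⟨⟩-suc n) ⟩
    sum (List.map (weight s t) (List.map prepend L List.++ List.map append L))
      ≈⟨ sum-++ (weight s t) (List.map prepend L) (List.map append L) ⟩
    sum (List.map (weight s t) (List.map prepend L)) + sum (List.map (weight s t) (List.map append L))
      ≈⟨ +-cong (sum-scale prepend _ (weight-prepend s t) L) (sum-scale append _ (weight-append s t) L) ⟩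
    p * u * s * t * total 1# t (suc n) + q * v * s * t * total s 1# (suc n) ∎
    where L = S⟨ [213] , [312] ⟩ (suc n)

-- Coefficients of products, and uniqueness of quotients.

module SeriesProperties {c ℓ} (R : CommutativeRing c ℓ) where

  private module R = CommutativeRing R
  open PowerSeries R using (Series; series; coeff; C; X; pointwise; at; InvertibleConstant; _/_; /-*)
  open CommutativeRing (PowerSeries.ring R)

  private
    -- This is by computation the tail of every `C a`, so the rest of a convolution with `C a` is a
    -- coefficient of `0s * f`.
    0s : Series
    0s = series λ _ → R.0#

    0s≈0 : 0s ≈ 0#
    0s≈0 = pointwise λ { zero → R.refl ; (suc _) → R.refl }

    -- The tail of `X`: splitting the first term off a coefficient of `X * f` leaves a coefficient
    -- of `X/x * f`.
    X/x : Series
    X/x = series (coeff X ∘ suc)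

    X/x≈1 : X/x ≈ 1#
    X/x≈1 = pointwise λ { zero → R.refl ; (suc _) → R.refl }

  coeff-X*-zero : ∀ f → coeff (X * f) 0 R.≈ R.0#
  coeff-X*-zero f = R.trans (R.+-identityʳ _) (R.zeroˡ _)

  coeff-X*-suc : ∀ f n → coeff (X * f) (suc n) R.≈ coeff f n
  coeff-X*-suc f n = R.trans
    (R.+-cong (R.zeroˡ _) (at (trans (*-congʳ {f} {X/x} X/x≈1) (*-identityˡ f)) n)) (R.+-identityˡ _)

  coeff-C* : ∀ a f n → coeff (C a * f) n R.≈ a R.* coeff f n
  coeff-C* a f zero    = R.+-identityʳ _
  coeff-C* a f (suc n) = R.trans
    (R.+-congˡ (at (trans (*-congʳ {f} {0s} 0s≈0) (trans (zeroˡ f) (sym 0s≈0))) n)) (R.+-identityʳ _)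

  C-* : ∀ a b → C (a R.* b) ≈ C a * C b
  C-* a b = sym (pointwise λ
    { zero    → R.+-identityʳ _
    ; (suc n) → R.trans (coeff-C* a (C b) (suc n)) (R.zeroʳ a)
    })

  C-*₄ : ∀ a b d e → C (a R.* b R.* d R.* e) ≈ C a * C b * C d * C e
  C-*₄ a b d e = trans (C-* _ e) (*-congʳ (trans (C-* _ d) (*-congʳ (C-* a b))))

  constant+X* : ∀ {f g a} → coeff f 0 R.≈ a → (∀ n → coeff f (suc n) R.≈ coeff g n) →
                f ≈ C a + X * g
  constant+X* {f} {g} {a} f₀ fₛ = pointwise λ
    { zero    → R.trans f₀ (R.trans (R.sym (R.+-identityʳ a)) (R.+-congˡ (R.sym (coeff-X*-zero g))))
    ; (suc n) → R.trans (fₛ n) (R.trans (R.sym (R.+-identityˡ _)) (R.+-congˡ (R.sym (coeff-X*-suc g n))))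
    }

  -- g₀ is deliberately not an instance argument: unification then copies it
  -- from the goal, where comparing two instances would unfold their proofs.
  /-unique : ∀ {f h} g (g₀ : InvertibleConstant g) → h * g ≈ f → h ≈ (f / g) ⦃ g₀ ⦄
  /-unique {f} {h} g g₀ h*g≈f = begin
    h                      ≈⟨ *-identityʳ h ⟨
    h * 1#                 ≈⟨ *-congˡ g*1/g≈1 ⟨
    h * (g * (1# / g))     ≈⟨ *-assoc h g _ ⟨
    h * g * (1# / g)       ≈⟨ *-congʳ (trans h*g≈f (sym (/-* f g))) ⟩
    f / g * g * (1# / g)   ≈⟨ *-assoc _ g _ ⟩
    f / g * (g * (1# / g)) ≈⟨ *-congˡ g*1/g≈1 ⟩
    f / g * 1#             ≈⟨ *-identityʳ _ ⟩
    f / g                  ∎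
    where
    open Relation.Binary.Reasoning.Setoid setoid
    instance
      _ : InvertibleConstant g
      _ = g₀

    g*1/g≈1 : g * (1# / g) ≈ 1#
    g*1/g≈1 = trans (*-comm g (1# / g)) (/-* 1# g)

-- Solving the triangular linear system.

module LinearSystem {c ℓ} (K : CommutativeRing c ℓ) where

  open CommutativeRing K
  open Algebra.Properties.Semiring.Exp semiring using (_^_)
  open Algebra.Properties.Ring ring using (-‿distribˡ-*; -‿distribʳ-*; -‿involutive; -‿+-comm)
  open Algebra.Solver.Ring.NaturalCoefficients.Default commutativeSemiring
  open Relation.Binary.Reasoning.Setoid setoid

  -- Moving `e * f` to the left gives `f * (1# - e) ≈ c`, and `i` cancels the factor `1# - e`.
  linear-solution : ∀ {f c e i} → i * (1# - e) ≈ 1# → f ≈ c + e * f → f ≈ c * i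
  linear-solution {f} {c} {e} {i} i-inv f-eq = begin
    f                  ≈⟨ *-identityʳ f ⟨
    f * 1#             ≈⟨ *-congˡ i-inv ⟨
    f * (i * (1# - e)) ≈⟨ *-congˡ (*-comm i _) ⟩
    f * ((1# - e) * i) ≈⟨ *-assoc f _ i ⟨
    f * (1# - e) * i   ≈⟨ *-congʳ f[1-e]≈c ⟩
    c * i              ∎
    where
    f[1-e]≈c : f * (1# - e) ≈ c
    f[1-e]≈c = begin
      f * (1# - e)             ≈⟨ distribˡ f 1# _ ⟩
      f * 1# + f * - e         ≈⟨ +-cong (trans (*-identityʳ f) f-eq)
                                           (trans (sym (-‿distribʳ-* f e)) (-‿cong (*-comm f e))) ⟩
      c + e * f + - (e * f)    ≈⟨ +-assoc c _ _ ⟩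
      c + (e * f + - (e * f))  ≈⟨ +-congˡ (-‿inverseʳ _) ⟩
      c + 0#                   ≈⟨ +-identityʳ c ⟩
      c                        ∎

  -1+≈-[1-] : ∀ a → - 1# + a ≈ - (1# - a)
  -1+≈-[1-] a = trans (+-congˡ (sym (-‿involutive a))) (-‿+-comm 1# (- a))

  -- Two denominators of the theorem are products of negated factors; their two signs cancel.
  inverse-product : ∀ f {i j a b} → i * (1# - a) ≈ 1# → j * (1# - b) ≈ 1# →
                    f * (i * j) * ((- 1# + a) * (- 1# + b)) ≈ f
  inverse-product f {i} {j} {a} {b} i-inv j-inv = begin
    f * (i * j) * ((- 1# + a) * (- 1# + b)) ≈⟨ *-congˡ (*-cong (-1+≈-[1-] a) (-1+≈-[1-] b)) ⟩
    f * (i * j) * (- (1# - a) * - (1# - b)) ≈⟨ *-congˡ neg*neg ⟩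
    f * (i * j) * ((1# - a) * (1# - b))
      ≈⟨ solve 5 (λ f i j a b → f :* (i :* j) :* (a :* b) := f :* ((i :* a) :* (j :* b)))
           refl f i j _ _ ⟩
    f * (i * (1# - a) * (j * (1# - b)))     ≈⟨ *-congˡ (*-cong i-inv j-inv) ⟩
    f * (1# * 1#)                           ≈⟨ *-congˡ (*-identityʳ 1#) ⟩
    f * 1#                                  ≈⟨ *-identityʳ f ⟩
    f                                       ∎
    where
    neg*neg : ∀ {y z} → - y * - z ≈ y * z
    neg*neg {y} {z} = trans (sym (-‿distribˡ-* y (- z)))
      (trans (-‿cong (sym (-‿distribʳ-* y z))) (-‿involutive _))

  -- `G`, `A`, `B` and `W` are the instances at (1,1), (1,t), (s,1) and (s,t). The factors `1#` are
  -- left in place so that all four hypotheses are literal instances of one recursion.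
  module System (x p q u v s t i j k : Carrier)
    (i-inv : i * (1# - p * t * u * x) ≈ 1#)
    (j-inv : j * (1# - (p * u * x + q * v * x)) ≈ 1#)
    (k-inv : k * (1# - q * s * v * x) ≈ 1#)
    {G A B W : Carrier}
    (G-rec : G ≈ u * v * 1# * 1# + x * (p * u * 1# * 1# * G + q * v * 1# * 1# * G))
    (A-rec : A ≈ u * v * 1# * t + x * (p * u * 1# * t * A + q * v * 1# * t * G))
    (B-rec : B ≈ u * v * s * 1# + x * (p * u * s * 1# * G + q * v * s * 1# * B))
    (W-rec : W ≈ u * v * s * t + x * (p * u * s * t * A + q * v * s * t * B))
    where

    G-closed : G ≈ u * v * j
    G-closed = linear-solution j-inv (trans G-rec
      (solve 6 (λ x p q u v g →
         u :* v :* con 1 :* con 1 :+ x :* (p :* u :* con 1 :* con 1 :* g :+ q :* v :* con 1 :* con 1 :* g)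
         := u :* v :+ (p :* u :* x :+ q :* v :* x) :* g)
       refl x p q u v _))

    A-closed : A ≈ (u * v * t + x * q * v * t * (u * v * j)) * i
    A-closed = linear-solution i-inv (begin
      A
        ≈⟨ A-rec ⟩
      u * v * 1# * t + x * (p * u * 1# * t * A + q * v * 1# * t * G)
        ≈⟨ +-congˡ (*-congˡ (+-congˡ (*-congˡ G-closed))) ⟩
      u * v * 1# * t + x * (p * u * 1# * t * A + q * v * 1# * t * (u * v * j))
        ≈⟨ solve 8 (λ x p q u v t g a →
             u :* v :* con 1 :* t :+ x :* (p :* u :* con 1 :* t :* a :+ q :* v :* con 1 :* t :* g)
             := u :* v :* t :+ x :* q :* v :* t :* g :+ p :* t :* u :* x :* a)
           refl x p q u v t _ _ ⟩
      u * v * t + x * q * v * t * (u * v * j) + p * t * u * x * A ∎)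

    B-closed : B ≈ (u * v * s + x * p * u * s * (u * v * j)) * k
    B-closed = linear-solution k-inv (begin
      B
        ≈⟨ B-rec ⟩
      u * v * s * 1# + x * (p * u * s * 1# * G + q * v * s * 1# * B)
        ≈⟨ +-congˡ (*-congˡ (+-congʳ (*-congˡ G-closed))) ⟩
      u * v * s * 1# + x * (p * u * s * 1# * (u * v * j) + q * v * s * 1# * B)
        ≈⟨ solve 8 (λ x p q u v s g b →
             u :* v :* s :* con 1 :+ x :* (p :* u :* s :* con 1 :* g :+ q :* v :* s :* con 1 :* b)
             := u :* v :* s :+ x :* p :* u :* s :* g :+ q :* s :* v :* x :* b)
           refl x p q u v s _ _ ⟩
      u * v * s + x * p * u * s * (u * v * j) + q * s * v * x * B ∎)

    solution : 1# + x * W ≈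
      1# + x * u * v * s * t
      + p * q * s * t ^ 2 * u ^ 2 * v ^ 2 * x ^ 3 * (i * j)
      + q * s ^ 2 * t * u * v ^ 2 * x ^ 2 * k
      + p * s * t ^ 2 * u ^ 2 * v * x ^ 2 * i
      + p * q * s ^ 2 * t * u ^ 2 * v ^ 2 * x ^ 3 * (j * k)
    solution = begin
      1# + x * W
        ≈⟨ +-congˡ (*-congˡ W-rec) ⟩
      1# + x * (u * v * s * t + x * (p * u * s * t * A + q * v * s * t * B))
        ≈⟨ +-congˡ (*-congˡ (+-congˡ (*-congˡ (+-cong (*-congˡ A-closed) (*-congˡ B-closed))))) ⟩
      1# + x * (u * v * s * t + x * (p * u * s * t * ((u * v * t + x * q * v * t * (u * v * j)) * i)
                                   + q * v * s * t * ((u * v * s + x * p * u * s * (u * v * j)) * k)))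
        -- With the inverses `i`, `j`, `k` as further variables, a polynomial identity remains.
        ≈⟨ solve 10 (λ x p q u v s t i j k →
             con 1 :+ x :* (u :* v :* s :* t
               :+ x :* (p :* u :* s :* t :* ((u :* v :* t :+ x :* q :* v :* t :* (u :* v :* j)) :* i)
                        :+ q :* v :* s :* t :* ((u :* v :* s :+ x :* p :* u :* s :* (u :* v :* j)) :* k)))
             := con 1 :+ x :* u :* v :* s :* t
                :+ p :* q :* s :* t :^ 2 :* u :^ 2 :* v :^ 2 :* x :^ 3 :* (i :* j)
                :+ q :* s :^ 2 :* t :* u :* v :^ 2 :* x :^ 2 :* k
                :+ p :* s :* t :^ 2 :* u :^ 2 :* v :* x :^ 2 :* i
                :+ p :* q :* s :^ 2 :* t :* u :^ 2 :* v :^ 2 :* x :^ 3 :* (j :* k))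
           refl x p q u v s t i j k ⟩
      _ ∎

-- The generating series of the weights and its closed form.

module TotalSeries {c ℓ} (R : CommutativeRing c ℓ) (p q u v : CommutativeRing.Carrier R) where

  private
    module R = CommutativeRing R
  open PowerSeries R using (Series; series; C; X)
  open CommutativeRing (PowerSeries.ring R)
  open SeriesProperties R
  open Weights R p q u v

  -- The terms of degree at least 1, divided by x.
  totals : R.Carrier → R.Carrier → Series
  totals s t = series λ n → total s t (suc n)

  -- The constant term comes from the one-letter word, the other coefficients from `total-suc`,
  -- whose scalars become constant series.
  totals-rec : ∀ s t → totals s t ≈
               C u * C v * C s * C t
               + X * (C p * C u * C s * C t * totals R.1# t + C q * C v * C s * C t * totals s R.1#)
  totals-rec s t = trans
    (constant+X* {g = C (p R.* u R.* s R.* t) * totals R.1# t + C (q R.* v R.* s R.* t) * totals s R.1#}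
      (total-1 s t)
      λ n → R.trans (total-suc s t n)
        (R.sym (R.+-cong (coeff-C* _ (totals R.1# t) n) (coeff-C* _ (totals s R.1#) n))))
    (+-cong (C-*₄ u v s t)
      (*-congˡ {X} (+-cong (*-congʳ {totals R.1# t} (C-*₄ p u s t)) (*-congʳ {totals s R.1#} (C-*₄ q v s t)))))

module ClosedForm {c ℓ} (R : CommutativeRing c ℓ) (p′ q′ u′ v′ s′ t′ : CommutativeRing.Carrier R) where

  private
    module R = CommutativeRing R
  open PowerSeries R
    using ( Series; C; X; _/_; /-*
          ; 1-invertible; neg-invertible; +X-invertible; -X-invertible; *-invertible )
  open CommutativeRing (PowerSeries.ring R)
  open Algebra.Properties.Semiring.Exp semiring using (_^_)
  open Algebra.Properties.Ring ring using (-‿+-comm)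
  open SeriesProperties R
  open TotalSeries R p′ q′ u′ v′
  open LinearSystem (PowerSeries.ring R)

  private
    x p q u v s t : Series
    x = X
    p = C p′
    q = C q′
    u = C u′
    v = C v′
    s = C s′
    t = C t′

    g₁ g₂ g₃ : Series
    g₁ = 1# / (1# - p * t * u * x)
    g₂ = 1# / (1# - p * u * x - q * v * x)
    g₃ = 1# / (1# - q * s * v * x)

    g₁-inv : g₁ * (1# - p * t * u * x) ≈ 1#
    g₁-inv = /-* 1# (1# - p * t * u * x)

    -- Regroups the denominator into the shape `1# - e` that `linear-solution` expects.
    g₂-inv : g₂ * (1# - (p * u * x + q * v * x)) ≈ 1#
    g₂-inv = trans (*-congˡ {g₂} (trans (+-congˡ (sym (-‿+-comm _ _))) (sym (+-assoc _ _ _))))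
      (/-* 1# (1# - p * u * x - q * v * x))

    g₃-inv : g₃ * (1# - q * s * v * x) ≈ 1#
    g₃-inv = /-* 1# (1# - q * s * v * x)

    cancel : ∀ f {g e} → g * e ≈ 1# → f * g * e ≈ f
    cancel f g-inv = trans (*-assoc f _ _) (trans (*-congˡ {f} g-inv) (*-identityʳ f))

    f₁ f₂ f₃ f₄ : Series
    f₁ = p * q * s * t ^ 2 * u ^ 2 * v ^ 2 * x ^ 3
    f₂ = q * s ^ 2 * t * u * v ^ 2 * x ^ 2
    f₃ = p * s * t ^ 2 * u ^ 2 * v * x ^ 2
    f₄ = p * q * s ^ 2 * t * u ^ 2 * v ^ 2 * x ^ 3

  -- Products with reciprocals are the form in which `System.solution` delivers the terms; the
  -- equations below let `/-unique` turn them into quotients.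
  quotient₁ quotient₂ quotient₃ quotient₄ : Series
  quotient₁ = f₁ * (g₁ * g₂)
  quotient₂ = f₂ * g₃
  quotient₃ = f₃ * g₁
  quotient₄ = f₄ * (g₂ * g₃)

  quotient₁-* : quotient₁ * ((- 1# + p * t * u * x) * (- 1# + p * u * x + q * v * x)) ≈ f₁
  quotient₁-* = trans (*-congˡ {quotient₁} (*-congˡ { - 1# + p * t * u * x} (+-assoc _ _ _)))
    (inverse-product f₁ g₁-inv g₂-inv)

  quotient₂-* : quotient₂ * (1# - q * s * v * x) ≈ f₂
  quotient₂-* = cancel f₂ g₃-inv

  quotient₃-* : quotient₃ * (1# - p * t * u * x) ≈ f₃
  quotient₃-* = cancel f₃ g₁-inv

  quotient₄-* : quotient₄ * ((- 1# + p * u * x + q * v * x) * (- 1# + q * s * v * x)) ≈ f₄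
  quotient₄-* = trans (*-congˡ {quotient₄} (*-congʳ { - 1# + q * s * v * x} (+-assoc _ _ _)))
    (inverse-product f₄ g₂-inv g₃-inv)

  1+X*totals : 1# + x * totals s′ t′ ≈
               1# + x * u * v * s * t + quotient₁ + quotient₂ + quotient₃ + quotient₄
  -- The unit series is `C R.1#` by definition, so putting `s` or `t` to one in `totals-rec` gives
  -- the hypotheses exactly.
  1+X*totals = System.solution x p q u v s t g₁ g₂ g₃ g₁-inv g₂-inv g₃-inv
    (totals-rec R.1# R.1#) (totals-rec R.1# t′) (totals-rec s′ R.1#) (totals-rec s′ t′)

-- The generating function as a sum of quotients.

open import Defs

theorem11 : F [213] [312] ≈
    1# + x * u * v * s * t
    + (p * q * s * t ^ 2 * u ^ 2 * v ^ 2 * x ^ 3) / ((- 1# + p * t * u * x) * (- 1# + p * u * x + q * v * x))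
    + (q * s ^ 2 * t * u * v ^ 2 * x ^ 2) / (1# - q * s * v * x)
    + (p * s * t ^ 2 * u ^ 2 * v * x ^ 2) / (1# - p * t * u * x)
    + (p * q * s ^ 2 * t * u ^ 2 * v ^ 2 * x ^ 3) / ((- 1# + p * u * x + q * v * x) * (- 1# + q * s * v * x))
theorem11 = K.trans F-split (K.trans 1+X*totals
  (K.+-cong (K.+-cong (K.+-cong (K.+-congˡ
    (/-unique _ _ quotient₁-*))
    (/-unique _ _ quotient₂-*))
    (/-unique _ _ quotient₃-*))
    (/-unique _ _ quotient₄-*)))
  where
  module K = CommutativeRing ℤ⟦ 7 ⟧
  module R = Coefficients
  open SeriesProperties ℤ⟦ 6 ⟧
  open TotalSeries ℤ⟦ 6 ⟧ R.p R.q R.u R.v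
  open Weights ℤ⟦ 6 ⟧ R.p R.q R.u R.v using (total; total-0)
  open ClosedForm ℤ⟦ 6 ⟧ R.p R.q R.u R.v R.s R.t

  -- Both weights unfold to the same product, so they are compared one permutation at a time.
  sum-weights : ∀ n → R.sum (List.map R.weight (S⟨ [213] , [312] ⟩ n)) ≡ total R.s R.t n
  sum-weights n = cong R.sum (map-cong (λ _ → ≡.refl) (S⟨ [213] , [312] ⟩ n))

  -- The empty permutation gives the constant term and stays outside the recursion.
  F-split : F [213] [312] ≈ 1# + x * totals R.s R.t
  F-split = constant+X* (R.trans (R.reflexive (sum-weights 0)) (total-0 R.s R.t))
    (λ n → R.reflexive (sum-weights (suc n)))
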